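{- Let $\kappa$ be an uncountable regular cardinal with $\kappa^{<\kappa}=\kappa$, and let $\mathbb{R}_\kappa$ be a $<\kappa$-closed version of $\kappa$-Mathias forcing with fusion. Then there is a $\mathbf{\Sigma}^1_1$ set that is not $\mathbb{R}_\kappa$-measurable.
   Context: The space $2^\kappa$ carries the topology generated by the sets $[s]=\{x\in2^\kappa:s\subset x\}$, $s\in2^{<\kappa}$ (similarly $\kappa^\kappa$). A set $X\subseteq 2^\kappa$ is $\mathbf{\Sigma}^1_1$ if it is the projection to $2^\kappa$ of a closed subset of $2^\kappa\times\kappa^\kappa$. Subsets of $\kappa$ are identified with their characteristic functions in $2^\kappa$. $\kappa$-Mathias forcing. A version of $\kappa$-Mathias forcing is given by a nonempty family $\mathcal{A}\subseteq[\kappa]^\kappa$ (the further requirement on the sets $A$; e.g. all club subsets of $\kappa$, or the members of a normal measure on $\kappa$). Conditions are pairs $(s,A)$ with $s\subset\kappa$, $|s|<\kappa$, $A\in\mathcal{A}$ and $\sup(s)<\min(A)$; the order is $(t,B)\le(s,A)$ iff $t\supseteq s$, $t$ end-extends $s$, $B\subseteq A$ and $t\setminus s\subseteq A$. The condition $(s,A)$ is identified with the tree $T_{(s,A)}\subseteq 2^{<\kappa}$ of all initial segments of characteristic functions of sets $x\subseteq\kappa$ such that $x$ end-extends $s$ and $x\setminus s\subseteq A$; $[T]=\{x\in2^\kappa:\forall\alpha<\kappa\,(x{\upharpoonright}\alpha\in T)\}$ is the set of branches of a tree $T$. The forcing is a tree-forcing: if $T\in\mathbb{R}_\kappa$ and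 $t\in T$, then $T_t=\{s\in T: s\subseteq t\vee t\subseteq s\}\in\mathbb{R}_\kappa$. It is required to be $<\kappa$-closed (every decreasing sequence of conditions of length $<\kappa$ has a lower bound) and to have fusion, i.e. there are partial orders $\{\le_\alpha:\alpha<\kappa\}$ on it with $\le_0=\le$, $\le_\beta\subseteq\le_\alpha$ for $\alpha<\beta$, and such that whenever $p_\beta\le_\alpha p_\alpha$ for all $\alpha<\beta<\kappa$ there is $q$ with $q\le_\alpha p_\alpha$ for all $\alpha<\kappa$. Tree-measurability. For a tree-forcing $\mathbb{P}$ and a set $X$ of $\kappa$-reals: $X$ is $\mathbb{P}$-open dense iff $\forall T\in\mathbb{P}\,\exists T'\le T\,([T']\subseteq X)$; the complement of a $\mathbb{P}$-open dense set is $\mathbb{P}$-nowhere dense; $X$ is $\mathbb{P}$-meager if it is covered by a union of at most $\kappa$ many $\mathbb{P}$-nowhere dense sets; $\mathcal{I}_{\mathbb{P}}$ is the ideal of $\mathbb{P}$-meager sets. $X$ is $\mathbb{P}$-measurable iff for every $T\in\mathbb{P}$ there is $T'\le T$ such that $[T']\cap X\in\mathcal{I}_{\mathbb{P}}$ or $[T']\setminus X\in\mathcal{I}_{\mathbb{P}}$. -}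

module Defs where

open import Level using (suc; _⊔_)
open import Data.Bool using (Bool; true)
open import Data.Nat using (ℕ)
open import Data.Product using (Σ-syntax; ∃-syntax; _×_; _,_; proj₁)
open import Data.Sum using (_⊎_)
open import Function.Bundles using (_⇔_; _↣_; _⤖_)
open import Induction.WellFounded using (WellFounded)
open import Relation.Binary using (Rel; IsStrictTotalOrder; IsPartialOrder; Irrelevant)
open import Relation.Binary.PropositionalEquality using (_≡_)
open import Relation.Nullary using (¬_)
open import Relation.Unary using (Pred; _⊆_; _∩_; _∖_; ∁; ⋃)
import Relation.Binary.Construct.StrictToNonStrict as ToNonStrict

-- A von Neumann ordinal is presented by the well-ordered type of its
-- elements.  Irrelevance of _<_ makes Seg α below have exactly one
-- element for each β < α.

record UncountableRegularCardinal ℓ : Set (suc ℓ) where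
  infix 4 _<_
  field
    Carrier            : Set ℓ
    _<_                : Rel Carrier ℓ
    isStrictTotalOrder : IsStrictTotalOrder _≡_ _<_
    <-irrelevant       : Irrelevant _<_
    <-wellFounded      : WellFounded _<_

  open ToNonStrict _≡_ _<_ public using (_≤_)

  Seg : Carrier → Set ℓ
  Seg α = Σ[ β ∈ Carrier ] β < α

  field
    initial     : ∀ α → ¬ (Carrier ↣ Seg α)
    regular     : ∀ α (f : Seg α → Carrier) → ∃[ β ] ∀ γ → f γ < β
    uncountable : ¬ (Carrier ↣ ℕ)

module GeneralizedReals {ℓ} (𝜿 : UncountableRegularCardinal ℓ) where

  open UncountableRegularCardinal 𝜿 public renaming (Carrier to κ)

  -- Seq B is B^{<κ}.
  Seq : ∀ {b} → Set b → Set (ℓ ⊔ b)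
  Seq B = Σ[ α ∈ κ ] (Seg α → B)

  κ^<κ≡κ : Set ℓ
  κ^<κ≡κ = Seq κ ⤖ κ

  -- Subsets of κ are identified with points of 2^κ.
  2^κ κ^κ : Set ℓ
  2^κ = κ → Bool
  κ^κ = κ → κ

  _↾_ : ∀ {b} {B : Set b} → (κ → B) → κ → Seq B
  x ↾ α = α , λ β → x (proj₁ β)

  -- u ⊏ x says that x lies in the basic open set [u].
  _⊏_ : ∀ {b} {B : Set b} → Seq B → (κ → B) → Set (ℓ ⊔ b)
  (α , u) ⊏ x = ∀ β → u β ≡ x (proj₁ β)

  -- Initial-segment order on sequences of length < κ.
  _⊑_ : ∀ {b} {B : Set b} → Rel (Seq B) (ℓ ⊔ b)
  (α , u) ⊑ (β , v) =
    (α ≤ β) × (∀ γ (γ<α : γ < α) (γ<β : γ < β) → u (γ , γ<α) ≡ v (γ , γ<β))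

  Open : Pred (2^κ × κ^κ) ℓ → Set ℓ
  Open U = ∀ x f → U (x , f) →
    Σ[ u ∈ Seq Bool ] Σ[ v ∈ Seq κ ]
      (u ⊏ x) × (v ⊏ f) × (∀ y g → u ⊏ y → v ⊏ g → U (y , g))

  Closed : Pred (2^κ × κ^κ) ℓ → Set ℓ
  Closed C = Open (∁ C)

  Σ¹₁ : Pred 2^κ ℓ → Set (suc ℓ)
  Σ¹₁ X = Σ[ C ∈ Pred (2^κ × κ^κ) ℓ ]
    Closed C × (∀ x → X x ⇔ (∃[ f ] C (x , f)))

  infix 4 _∈_ _∉_
  _∈_ _∉_ : κ → 2^κ → Set
  α ∈ x = x α ≡ true
  α ∉ x = ¬ (α ∈ x)

  ⟪_⟫ : 2^κ → Set ℓ
  ⟪ x ⟫ = ∃[ α ] α ∈ x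

  [κ]^κ : Pred 2^κ ℓ
  [κ]^κ x = ⟪ x ⟫ ⤖ κ

  Small : Pred 2^κ ℓ
  Small x = ∃[ α ] (⟪ x ⟫ ↣ Seg α)

  infix 4 _⊆ₛ_ _≗ₛ_
  _⊆ₛ_ _≗ₛ_ : Rel 2^κ ℓ
  x ⊆ₛ y = ∀ {α} → α ∈ x → α ∈ y
  x ≗ₛ y = ∀ α → x α ≡ y α

  EndExtends : Rel 2^κ ℓ
  EndExtends x s =
    (s ⊆ₛ x) × (∀ {ξ η} → ξ ∈ x → ξ ∉ s → η ∈ s → η < ξ)

  -- x ∖ s ⊆ A
  Diff⊆ : 2^κ → 2^κ → 2^κ → Set ℓ
  Diff⊆ x s A = ∀ {ξ} → ξ ∈ x → ξ ∉ s → ξ ∈ A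

  IsSup : 2^κ → κ → Set ℓ
  IsSup s σ = (∀ {ξ} → ξ ∈ s → ξ ≤ σ)
            × (∀ τ → (∀ {ξ} → ξ ∈ s → ξ ≤ τ) → σ ≤ τ)

-- The two readings of the side condition "sup(s) < min(A)".  They differ
-- only when s has no maximum (in particular when s is empty).
--
-- `strict` is the literal one, with sup(∅) = 0.  Under it, if A contains
-- one of its own limit points γ and t is (the characteristic function of)
-- a cofinal subset of A ∩ γ, then T_t is not the tree of any condition,
-- so that e.g. the family of all clubs does not give a tree-forcing.
--
-- `pointwise` asks that every element of s be below every element of A;
-- with it, clubs and normal measures do give tree-forcings.

data Reading : Set where
  strict pointwise : Reading

module Forcing {ℓ} (𝜿 : UncountableRegularCardinal ℓ) where

  open GeneralizedReals 𝜿

  [_] : Pred (Seq Bool) ℓ → Pred 2^κ ℓ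
  [ T ] x = ∀ α → T (x ↾ α)

  module TreeMeasurability {P : Set ℓ} (_≼_ : Rel P ℓ) (tree : P → Pred (Seq Bool) ℓ) where

    OpenDense : Pred 2^κ ℓ → Set ℓ
    OpenDense X = ∀ p → ∃[ q ] (q ≼ p) × ([ tree q ] ⊆ X)

    NowhereDense : Pred 2^κ ℓ → Set ℓ
    NowhereDense X = OpenDense (∁ X)

    -- Empty sets are nowhere dense and repetitions are allowed, so
    -- indexing by κ amounts to "at most κ many".
    Meager : Pred 2^κ ℓ → Set (suc ℓ)
    Meager X = Σ[ N ∈ (κ → Pred 2^κ ℓ) ] (∀ α → NowhereDense (N α)) × (X ⊆ ⋃ κ N)

    Measurable : Pred 2^κ ℓ → Set (suc ℓ)
    Measurable X = ∀ p → ∃[ q ] (q ≼ p) ×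
      (Meager ([ tree q ] ∩ X) ⊎ Meager ([ tree q ] ∖ X))

  Below : Reading → Rel 2^κ ℓ
  Below strict    s A = ∃[ σ ] IsSup s σ × (∀ {η} → η ∈ A → σ < η)
  Below pointwise s A = ∀ {ξ η} → ξ ∈ s → η ∈ A → ξ < η

  module Mathias (𝒜 : Pred 2^κ ℓ) (reading : Reading) where

    record Condition : Set ℓ where
      field
        stem  : 2^κ
        side  : 2^κ
        small : Small stem
        side∈ : 𝒜 side
        below : Below reading stem side

    open Condition public

    infix 4 _≈_ _≼_

    _≈_ : Rel Condition ℓ
    p ≈ q = (stem p ≗ₛ stem q) × (side p ≗ₛ side q)

    _≼_ : Rel Condition ℓ
    q ≼ p = EndExtends (stem q) (stem p)
          × (side q ⊆ₛ side p)
          × Diff⊆ (stem q) (stem p) (side p)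

    tree : Condition → Pred (Seq Bool) ℓ
    tree p u = ∃[ x ] EndExtends x (stem p) × Diff⊆ x (stem p) (side p) × (u ⊏ x)

    IsTreeForcing : Set ℓ
    IsTreeForcing = ∀ p t → tree p t →
      ∃[ q ] (∀ u → tree q u ⇔ (tree p u × ((u ⊑ t) ⊎ (t ⊑ u))))

    -- α may be the least element of κ, so the empty sequence is included
    -- and Condition is inhabited.
    <κ-Closed : Set ℓ
    <κ-Closed = ∀ α (p : Seg α → Condition) →
      (∀ β γ → proj₁ β < proj₁ γ → p γ ≼ p β) →
      ∃[ q ] (∀ β → q ≼ p β)

    record Fusion : Set (suc ℓ) where
      field
        ≼[_]           : κ → Rel Condition ℓ
        isPartialOrder : ∀ α → IsPartialOrder _≈_ ≼[ α ]
        ≼[0]           : ∀ {α} → (∀ β → ¬ (β < α)) → ∀ p q → ≼[ α ] p q ⇔ (p ≼ q)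
        decreasing     : ∀ {α β} → α < β → ∀ {p q} → ≼[ β ] p q → ≼[ α ] p q
        fusion         : ∀ (p : κ → Condition) →
                         (∀ {α β} → α < β → ≼[ α ] (p β) (p α)) →
                         ∃[ q ] (∀ α → ≼[ α ] q (p α))

    open TreeMeasurability _≼_ tree public

{-# OPTIONS --safe #-}

-- X consists of the x for which, at club many δ, the part of x between δ and
-- its next limit point is red in the Erdős–Rado colouring of countable sets:
-- thinning it out decreases its code under a fixed well-ordering of 2^{<κ}.
-- Every unbounded set has ω-type subsets of both colours: one of least code is
-- blue, and adding a point to one of least code among those omitting
-- cofinally many points gives a red one.  Given a condition p and κ many
-- nowhere dense sets, a descending κ-sequence of conditions below p avoids
-- them one at a time, and at each stage ω more points of either chosen colour
-- are put above the stem.  The union of the stems is a branch of p in or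
-- outside X as desired.

module Submission where

open import Defs
open import Axiom.ExcludedMiddle using (ExcludedMiddle)
open import Axiom.Extensionality.Propositional using (Extensionality)
open import Axiom.UniquenessOfIdentityProofs using (module Decidable⇒UIP)
open import Data.Bool using (Bool; true; false; if_then_else_)
import Data.Bool.Properties as Bool
open import Data.Empty using (⊥)
open import Data.Nat using (ℕ; zero; suc; z≤n) renaming (_<_ to _<ℕ_; _≤_ to _≤ℕ_)
import Data.Nat.Properties as ℕ
open import Data.Product using (Σ-syntax; ∃; ∃-syntax; _×_; _,_; proj₁; proj₂)
open import Data.Product.Properties using (,-injectiveʳ-UIP)
open import Data.Sum using (_⊎_; inj₁; inj₂)
open import Function using (_∘_; id; case_of_)
open import Function.Bundles using (_↣_; mk↣; mk⇔; module Injection; module Bijection; module Equivalence)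
open import Function.Construct.Composition using (_↣-∘_)
open import Function.Properties.Bijection using (sym-≡)
open import Induction.WellFounded using (WfRec; module All; module FixPoint)
open import Relation.Binary using (IsStrictTotalOrder; tri<; tri≈; tri>)
open import Relation.Binary.PropositionalEquality using (_≡_; _≢_; refl; sym; trans; cong; cong-app; subst)
open import Relation.Nullary using (¬_; Dec; yes; no; does; contradiction)
open import Relation.Nullary.Decidable using (decidable-stable; dec-true)
open import Relation.Unary using (Pred; Satisfiable; _⊆_; _∩_; _∖_; ∁)

module Classical (em : ∀ {a} → ExcludedMiddle a) (ext : ∀ {a b} → Extensionality a b)
                 {ℓ} (𝜿 : UncountableRegularCardinal ℓ) where

  open GeneralizedReals 𝜿
  open IsStrictTotalOrder isStrictTotalOrder using (compare; irrefl; _≟_) renaming (trans to <-trans)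

  -- Order, least elements and bounds in κ.

  ¬∀⇒∃¬ : ∀ {a b} {A : Set a} {P : A → Set b} → ¬ (∀ x → P x) → ∃[ x ] ¬ P x
  ¬∀⇒∃¬ ¬∀ = decidable-stable em λ ¬∃ → ¬∀ λ x → decidable-stable em λ ¬p → ¬∃ (x , ¬p)

  <-irrefl : ∀ {α} → ¬ (α < α)
  <-irrefl = irrefl refl

  <-asym : ∀ {α β} → α < β → ¬ (β < α)
  <-asym α<β β<α = <-irrefl (<-trans α<β β<α)

  ≮⇒≥ : ∀ {α β} → ¬ (α < β) → β ≤ α
  ≮⇒≥ {α} {β} α≮β with compare α β
  ... | tri< α<β _ _ = contradiction α<β α≮β
  ... | tri≈ _ α≡β _ = inj₂ (sym α≡β)
  ... | tri> _ _ β<α = inj₁ β<α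

  ≤⇒≯ : ∀ {α β} → α ≤ β → ¬ (β < α)
  ≤⇒≯ (inj₁ α<β) = <-asym α<β
  ≤⇒≯ (inj₂ refl) = <-irrefl

  ≤-<-trans : ∀ {α β γ} → α ≤ β → β < γ → α < γ
  ≤-<-trans (inj₁ α<β) β<γ = <-trans α<β β<γ
  ≤-<-trans (inj₂ refl) β<γ = β<γ

  <-≤-trans : ∀ {α β γ} → α < β → β ≤ γ → α < γ
  <-≤-trans α<β (inj₁ β<γ) = <-trans α<β β<γ
  <-≤-trans α<β (inj₂ refl) = α<β

  least : ∀ {a} (P : κ → Set a) → ∃ P → ∃[ μ ] P μ × (∀ {ν} → P ν → μ ≤ ν)
  least P (α , Pα) = All.wfRec <-wellFounded _ (λ α → P α → ∃[ μ ] P μ × (∀ {ν} → P ν → μ ≤ ν)) go α Pα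
    where
    go : ∀ α → (∀ {β} → β < α → P β → ∃[ μ ] P μ × (∀ {ν} → P ν → μ ≤ ν)) →
         P α → ∃[ μ ] P μ × (∀ {ν} → P ν → μ ≤ ν)
    go α rec Pα with em {P = ∃[ β ] β < α × P β}
    ... | yes (β , β<α , Pβ) = rec β<α Pβ
    ... | no ∄ = α , Pα , λ Pν → ≮⇒≥ λ ν<α → ∄ (_ , ν<α , Pν)

  -- Otherwise a constant map would embed κ into ℕ.
  pair : ∃[ α ] ∃[ β ] α < β
  pair with em {P = ∃[ α ] ∃[ β ] α < β}
  ... | yes p = p
  ... | no ∄ = contradiction (mk↣ {to = λ _ → 0} λ _ → unique) uncountable
    where
    unique : ∀ {α β} → α ≡ β
    unique {α} {β} with compare α β
    ... | tri< α<β _ _ = contradiction (α , β , α<β) ∄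
    ... | tri≈ _ α≡β _ = α≡β
    ... | tri> _ _ β<α = contradiction (β , α , β<α) ∄

  -- A constant map out of a nonempty segment shows that nothing is maximal.
  above : ∀ α → ∃[ β ] α < β
  above α with pair
  ... | o , o' , o<o' with regular o' (λ _ → α)
  ... | β , α<β = β , α<β (o , o<o')

  minimum : ∃[ μ ] ∀ ν → μ ≤ ν
  minimum = let μ , _ , minimal = least (λ α → α ≡ α) (proj₁ pair , refl) in μ , λ _ → minimal refl

  above₂ : ∀ α β → ∃[ γ ] α < γ × β < γ
  above₂ α β with compare α β | above α | above β
  ... | tri< α<β _ _ | _ | γ , β<γ = γ , <-trans α<β β<γ , β<γ
  ... | tri≈ _ refl _ | _ | γ , β<γ = γ , β<γ , β<γ
  ... | tri> _ _ β<α | γ , α<γ | _ = γ , α<γ , <-trans β<α α<γ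

  -- `regular` speaks only of maps on segments, so `f` is carried over along the partial inverse of
  -- `e`.
  bounded : ∀ {a} {A : Set a} {α} → A ↣ Seg α → (f : A → κ) → ∃[ β ] ∀ x → f x < β
  bounded {A = A} {α} e f = proj₁ b , λ x → bound x
    where
    open Injection e
    g : (γ : Seg α) → Dec (∃[ x ] to x ≡ γ) → κ
    g γ (yes (x , _)) = f x
    -- Off the range of `e` any value will do.
    g γ (no _) = proj₁ pair
    b : ∃[ β ] ∀ γ → g γ em < β
    b = regular α (λ γ → g γ em)
    bound : ∀ x → f x < proj₁ b
    bound x with em {P = ∃[ y ] to y ≡ to x} | proj₂ b (to x)
    ... | yes (y , eq) | fy<β = subst (λ z → f z < proj₁ b) (injective eq) fy<β
    ... | no ∄ | _ = contradiction (x , refl) ∄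

  -- Limits of ω-sequences and closure points.

  increasing : (f : ℕ → κ) → (∀ n → f n < f (suc n)) → ∀ {m n} → m <ℕ n → f m < f n
  increasing f step {m} {suc n} m<1+n with ℕ.m<1+n⇒m<n∨m≡n m<1+n
  ... | inj₁ m<n = <-trans (increasing f step m<n) (step n)
  ... | inj₂ refl = step n

  increasing⇒↣Seg : ∀ {β} (f : ℕ → κ) → (∀ n → f n < f (suc n)) → (∀ n → f n < β) → ℕ ↣ Seg β
  increasing⇒↣Seg f step f<β = mk↣ {to = λ n → f n , f<β n} λ eq → inj (cong proj₁ eq)
    where
    inj : ∀ {m n} → f m ≡ f n → m ≡ n
    inj {m} {n} eq with ℕ.<-cmp m n
    ... | tri< m<n _ _ = contradiction (subst (_< f n) eq (increasing f step m<n)) <-irrefl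
    ... | tri≈ _ m≡n _ = m≡n
    ... | tri> _ _ n<m = contradiction (subst (f n <_) eq (increasing f step n<m)) <-irrefl

  -- Iterating the successor either reaches every ordinal, which makes κ
  -- countable, or embeds ℕ into a proper segment.
  ω↣Seg : ∃[ α ] (ℕ ↣ Seg α)
  ω↣Seg = decidable-stable em λ ∄ → uncountable (cofinal⇒countable λ α →
      case ¬∀⇒∃¬ (λ h → ∄ (α , increasing⇒↣Seg nth nth-step h)) of λ (n , ≮) → reached n (≮⇒≥ ≮))
    where
    next : ∀ α → ∃[ μ ] α < μ × (∀ {ν} → α < ν → μ ≤ ν)
    next α = least (α <_) (above α)
    nth : ℕ → κ
    nth zero = proj₁ minimum
    nth (suc n) = proj₁ (next (nth n))
    nth-step : ∀ n → nth n < nth (suc n)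
    nth-step n = proj₁ (proj₂ (next (nth n)))
    reached : ∀ {α} n → α ≤ nth n → ∃[ m ] α ≡ nth m
    reached zero (inj₁ α<) = contradiction α< (≤⇒≯ (proj₂ minimum _))
    reached (suc n) (inj₁ α<) =
      reached n (≮⇒≥ λ n<α → ≤⇒≯ (proj₂ (proj₂ (next (nth n))) n<α) α<)
    reached n (inj₂ α≡) = n , α≡
    cofinal⇒countable : (∀ α → ∃[ n ] α ≡ nth n) → κ ↣ ℕ
    cofinal⇒countable h = mk↣ {to = proj₁ ∘ h} λ {α} {β} eq →
      trans (proj₂ (h α)) (trans (cong nth eq) (sym (proj₂ (h β))))

  supremum : ∀ {a} {A : Set a} (f : A → κ) → (∃[ β ] ∀ x → f x < β) →
             ∃[ δ ] (∀ x → f x < δ) × (∀ {ξ} → ξ < δ → ∃[ x ] ξ ≤ f x)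
  supremum f b with least (λ β → ∀ x → f x < β) b
  ... | δ , f<δ , minimal = δ , f<δ , λ ξ<δ →
    case ¬∀⇒∃¬ (λ h → ≤⇒≯ (minimal h) ξ<δ) of λ (x , ≮) → x , ≮⇒≥ ≮

  -- Since ℕ embeds into a proper segment, regularity bounds every ω-sequence: κ has uncountable
  -- cofinality.
  ω-limit : (f : ℕ → κ) → (∀ n → f n < f (suc n)) →
            ∃[ δ ] (∀ n → f n < δ) × (∀ {ξ} → ξ < δ → ∃[ n ] ξ ≤ f n)
  ω-limit f step = supremum f (bounded (proj₂ ω↣Seg) f)

  -- Each of ω many steps passes a bound for `g` on everything below the previous step.
  closure-point : (g : κ → κ) → ∃[ δ ] (∃[ ξ ] ξ < δ) × (∀ {ξ} → ξ < δ → g ξ < δ)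
  closure-point g = δ , (_ , f<δ 0) , λ ξ<δ → closed (cofinal ξ<δ)
    where
    step : ∀ α → ∃[ β ] α < β × (∀ {ξ} → ξ < α → g ξ < β)
    step α with regular α (g ∘ proj₁)
    ... | β , g<β with above₂ α β
    ... | γ , α<γ , β<γ = γ , α<γ , λ ξ<α → <-trans (g<β (_ , ξ<α)) β<γ
    f : ℕ → κ
    f zero = proj₁ pair
    f (suc n) = proj₁ (step (f n))
    f-step : ∀ n → f n < f (suc n)
    f-step n = proj₁ (proj₂ (step (f n)))
    limit = ω-limit f f-step
    δ = proj₁ limit
    f<δ = proj₁ (proj₂ limit)
    cofinal = proj₂ (proj₂ limit)
    closed : ∀ {ξ} → ∃[ n ] ξ ≤ f n → g ξ < δ
    -- `step` covers only ordinals strictly below its argument, and `ξ` may equal `f n`; hence the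
    -- shift to `f (suc n)`.
    closed (n , ξ≤) = <-trans
      (proj₂ (proj₂ (step (f (suc n)))) (≤-<-trans ξ≤ (f-step n))) (f<δ (suc (suc n)))

  -- Recursion of length κ.

  restrict : ∀ {a} {A : Set a} {α} → (Seg α → A) → (β : Seg α) → Seg (proj₁ β) → A
  restrict s (_ , β<α) (γ , γ<β) = s (γ , <-trans γ<β β<α)

  -- The recursion carries no proof that its history is correct, so it tests this and falls back on
  -- `default`; a second induction shows that the fallback never occurs.
  dependent-choice :
    ∀ {a p} {A : Set a} (P : ∀ α → (Seg α → A) → A → Set p) → A →
    (∀ α (s : Seg α → A) → (∀ β → P (proj₁ β) (restrict s β) (s β)) → ∃ (P α s)) →
    Σ[ f ∈ (κ → A) ] ∀ α → P α (f ∘ proj₁) (f α)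
  dependent-choice {a} {A = A} P default choose = f , All.wfRec <-wellFounded _ _ correct
    where
    Correct : ∀ α → (Seg α → A) → Set _
    Correct α s = ∀ β → P (proj₁ β) (restrict s β) (s β)
    pick : ∀ α (s : Seg α → A) → Dec (Correct α s) → A
    pick α s (yes c) = proj₁ (choose α s c)
    pick α s (no _) = default
    step : ∀ α → WfRec _<_ (λ _ → A) α → A
    step α rec = pick α (λ β → rec (proj₂ β)) em
    f : κ → A
    f = All.wfRec <-wellFounded a (λ _ → A) step
    unfold : ∀ α → f α ≡ step α (λ {β} _ → f β)
    unfold α = FixPoint.unfold-wfRec <-wellFounded (λ _ → A) step
      (λ α eq → cong (λ s → pick α s em) (ext λ β → eq (proj₂ β)))
    pick-correct : ∀ α s c → Correct α s → P α s (pick α s c)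
    pick-correct α s (yes c) _ = proj₂ (choose α s c)
    pick-correct α s (no ¬c) c = contradiction c ¬c
    correct : ∀ α → (∀ {β} → β < α → P β (f ∘ proj₁) (f β)) → P α (f ∘ proj₁) (f α)
    -- Restricting `f ∘ proj₁` to a shorter segment computes to `f ∘ proj₁` again, so `rec` fits.
    correct α rec = subst (P α (f ∘ proj₁)) (sym (unfold α))
      (pick-correct α _ em λ β → rec (proj₂ β))

  -- Subsets of κ.

  ⟦_⟧ : ∀ {a} → (κ → Set a) → 2^κ
  ⟦ P ⟧ ξ = does (em {P = P ξ})

  ∈⟦⟧⁺ : ∀ {a} (P : κ → Set a) {ξ} → P ξ → ξ ∈ ⟦ P ⟧
  ∈⟦⟧⁺ P = dec-true em

  ∈⟦⟧⁻ : ∀ {a} (P : κ → Set a) {ξ} → ξ ∈ ⟦ P ⟧ → P ξ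
  ∈⟦⟧⁻ P {ξ} ξ∈ with em {P = P ξ}
  ... | yes p = p

  ∈-ext : ∀ (x y : 2^κ) {ξ} → (ξ ∈ x → ξ ∈ y) → (ξ ∈ y → ξ ∈ x) → x ξ ≡ y ξ
  ∈-ext x y to from = Bool.⇔→≡ (mk⇔ to from)

  ⟪⟫-≡ : ∀ {x} {p q : ⟪ x ⟫} → proj₁ p ≡ proj₁ q → p ≡ q
  ⟪⟫-≡ {p = ξ , p} {q = _ , q} refl = cong (ξ ,_) (Decidable⇒UIP.≡-irrelevant Bool._≟_ p q)

  small⇒bounded : ∀ {x} → Small x → ∃[ β ] ∀ {ξ} → ξ ∈ x → ξ < β
  small⇒bounded (_ , e) with bounded e proj₁
  ... | β , x<β = β , λ ξ∈x → x<β (_ , ξ∈x)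

  ⊆-small : ∀ {x y} → x ⊆ₛ y → Small y → Small x
  ⊆-small x⊆y (α , e) = α , mk↣ {to = λ (ξ , ξ∈x) → Injection.to e (ξ , x⊆y ξ∈x)}
    λ eq → ⟪⟫-≡ (cong proj₁ (Injection.injective e eq))

  -- A bounded set embeds into a proper segment, but κ is an initial ordinal.
  unbounded : ∀ {x} → [κ]^κ x → ∀ α → ∃[ η ] η ∈ x × α < η
  unbounded {x} e α = decidable-stable em λ ∄ → let
      β , α<β = above α
      x<β : ∀ {ξ} → ξ ∈ x → ξ < β
      x<β ξ∈x = ≤-<-trans (≮⇒≥ λ α<ξ → ∄ (_ , ξ∈x , α<ξ)) α<β
      into : ⟪ x ⟫ ↣ Seg β
      into = mk↣ {to = λ (ξ , ξ∈x) → ξ , x<β ξ∈x} λ eq → ⟪⟫-≡ (cong proj₁ eq)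
    in initial β (into ↣-∘ Bijection.injection (sym-≡ e))

  -- Agreement below an ordinal and limit points.

  infix 4 _≡[_]_
  _≡[_]_ : 2^κ → κ → 2^κ → Set ℓ
  x ≡[ β ] y = ∀ {ξ} → ξ < β → x ξ ≡ y ξ

  IsLimit : 2^κ → κ → Set ℓ
  IsLimit x β = ∀ ξ → ξ < β → ∃[ η ] η ∈ x × ξ < η × η < β

  NextLimit : 2^κ → κ → κ → Set ℓ
  NextLimit x δ β = δ < β × IsLimit x β × (∀ {γ} → δ < γ → γ < β → ¬ IsLimit x γ)

  -- For the stem and side of a condition these `x` are exactly the branches of its tree.
  Extension : (s A x : 2^κ) → Set ℓ
  Extension s A x = EndExtends x s × Diff⊆ x s A

  IsLimit-mono : ∀ {x y β} → (∀ {η} → η < β → η ∈ x → η ∈ y) → IsLimit x β → IsLimit y β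
  IsLimit-mono x⊆y lim ξ ξ<β with lim ξ ξ<β
  ... | η , η∈x , ξ<η , η<β = η , x⊆y η<β η∈x , ξ<η , η<β

  ≡[]-sym : ∀ {x y β} → x ≡[ β ] y → y ≡[ β ] x
  ≡[]-sym eq ξ<β = sym (eq ξ<β)

  NextLimit-local : ∀ {x y δ β} → x ≡[ β ] y → NextLimit x δ β → NextLimit y δ β
  NextLimit-local eq (δ<β , lim , next) = δ<β
    , IsLimit-mono (λ η<β η∈x → trans (sym (eq η<β)) η∈x) lim
    , λ δ<γ γ<β → next δ<γ γ<β ∘ IsLimit-mono λ η<γ η∈y → trans (eq (<-trans η<γ γ<β)) η∈y

  NextLimit-unique : ∀ {x δ β γ} → NextLimit x δ β → NextLimit x δ γ → β ≡ γ
  NextLimit-unique {β = β} {γ} (δ<β , limβ , nextβ) (δ<γ , limγ , nextγ) with compare β γ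
  ... | tri< β<γ _ _ = contradiction limβ (nextγ δ<β β<γ)
  ... | tri≈ _ β≡γ _ = β≡γ
  ... | tri> _ _ γ<β = contradiction limγ (nextβ δ<γ γ<β)

  -- New points lie above all of `s`, which is cofinal in `β`. Hence a colour fixed below `β`
  -- survives all later extensions of the stem.
  EndExtends-limit : ∀ {x s β} → EndExtends x s → IsLimit s β → s ≡[ β ] x
  EndExtends-limit {x} {s} {β} (s⊆x , end) lim {ξ} ξ<β = ∈-ext s x s⊆x λ ξ∈x →
    decidable-stable (s ξ Bool.≟ true) λ ξ∉s →
      case lim ξ ξ<β of λ (η , η∈s , ξ<η , _) → <-asym ξ<η (end ξ∈x ξ∉s η∈s)

  _ClosedUnder_ : κ → κ^κ → Set ℓ
  δ ClosedUnder g = (∃[ ξ ] ξ < δ) × (∀ {ξ} → ξ < δ → g ξ < δ)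

  -- The values g δ bound the search for the next limit; the condition is
  -- vacuous except at the club of closure points of g.
  Controls : (2^κ → κ → κ → Set ℓ) → κ^κ → 2^κ → Set ℓ
  Controls K g x = ∀ δ → δ ClosedUnder g → ∃[ β ] β < g δ × NextLimit x δ β × K x δ β

  -- Codes of bounded sets and the colouring.

  module Coloring (enc : κ^<κ≡κ) where

    -- `enc` enumerates sequences of ordinals, so truth values become two distinct ordinals.
    bit : Bool → κ
    bit b = if b then proj₁ pair else proj₁ (proj₂ pair)

    bit-injective : ∀ {b c} → bit b ≡ bit c → b ≡ c
    bit-injective {false} {false} _ = refl
    bit-injective {false} {true} eq = contradiction (proj₂ (proj₂ pair)) (irrefl (sym eq))
    bit-injective {true} {false} eq = contradiction (proj₂ (proj₂ pair)) (irrefl eq)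
    bit-injective {true} {true} _ = refl

    -- The place of `x ↾ β` in the well-ordering of 2^<κ induced by `enc`.
    code : 2^κ → κ → κ
    code x β = Bijection.to enc ((bit ∘ x) ↾ β)

    code-injective : ∀ {x y β} → code x β ≡ code y β → x ≡[ β ] y
    code-injective eq ξ<β = bit-injective (cong-app
      (,-injectiveʳ-UIP (Decidable⇒UIP.≡-irrelevant _≟_) (Bijection.injective enc eq)) (_ , ξ<β))

    code-local : ∀ {x y β} → x ≡[ β ] y → code x β ≡ code y β
    code-local {β = β} eq =
      cong (λ u → Bijection.to enc (β , u)) (ext λ (_ , ξ<β) → cong bit (eq ξ<β))

    -- The Erdős–Rado colouring: a set is red if thinning it out above δ can
    -- decrease its code.
    Red : 2^κ → κ → κ → Set ℓ
    Red x δ β = ∃[ y ] (∀ {ξ} → ξ < β → ξ ∈ y → ξ ∈ x) × (∀ {ξ} → ξ ≤ δ → y ξ ≡ x ξ)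
                     × IsLimit y β × code y β < code x β

    -- The same thinning serves, since only points below `β` are inspected.
    Red-local : ∀ {x y δ β} → δ < β → x ≡[ β ] y → Red x δ β → Red y δ β
    Red-local δ<β eq (z , z⊆x , agree , lim , z<x) = z
      , (λ ξ<β ξ∈z → trans (sym (eq ξ<β)) (z⊆x ξ<β ξ∈z))
      , (λ ξ≤δ → trans (agree ξ≤δ) (eq (≤-<-trans ξ≤δ δ<β)))
      , lim
      , subst (code z _ <_) (code-local eq) z<x

    minimize : (Q : 2^κ → κ → Set ℓ) → (∃[ x ] ∃[ β ] Q x β) →
               ∃[ x ] ∃[ β ] Q x β × (∀ {y γ} → Q y γ → code x β ≤ code y γ)
    minimize Q (x , β , q)
      with least (λ α → ∃[ y ] ∃[ γ ] Q y γ × α ≡ code y γ) (_ , x , β , q , refl)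
    ... | _ , (y , γ , q' , refl) , minimal = y , γ , q' , λ q → minimal (_ , _ , q , refl)

    -- Both colours occur above every stem.

    module _ {s A δ} (s<δ : ∀ {ξ} → ξ ∈ s → ξ < δ) (cofinal : ∀ α → ∃[ η ] η ∈ A × α < η) where

      Candidate : 2^κ → κ → Set ℓ
      Candidate x β = Extension s A x × NextLimit x δ β

      -- Asking for cofinally many omitted points, not just one, makes the property survive adding a
      -- point.
      Spare : 2^κ → κ → Set ℓ
      Spare x β = ∀ {ξ} → ξ < β → ∃[ η ] η ∈ A × η ∉ x × ξ < η × η < β

      -- Every other term of an increasing ω-sequence in A.
      spare-candidate : ∃[ x ] ∃[ β ] Candidate x β × Spare x β
      spare-candidate = x , β
        , ( (((λ ξ∈s → ∈⟦⟧⁺ P (inj₁ ξ∈s)) , end) , diff)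
          , <-trans (δ<a 0) (a<β 0)
          , (λ _ ξ<β → case reach ξ<β of λ (n , ξ≤) →
              a (suc n) , ∈⟦⟧⁺ P (inj₂ (suc n , refl)) , ≤-<-trans ξ≤ (a-step n) , a<β (suc n))
          , λ δ<γ γ<β lim → no-limit δ<γ lim (proj₁ (reach γ<β)) (proj₂ (reach γ<β)) )
        , λ ξ<β → case reach ξ<β of λ (n , ξ≤) →
            next (a n) , next∈A (a n)
            , (λ η∈x → case ∈⟦⟧⁻ P η∈x of λ where
                 (inj₁ η∈s) → <-asym (s<δ η∈s) (<-trans (δ<a n) (<next (a n)))
                 (inj₂ (m , eq)) → gap n (<next (a n)) (<next (next (a n))) m eq)
            , ≤-<-trans ξ≤ (<next (a n)) , <-trans (<next (next (a n))) (a<β (suc n))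
        where
        next : κ → κ
        next α = proj₁ (cofinal α)
        next∈A : ∀ α → next α ∈ A
        next∈A α = proj₁ (proj₂ (cofinal α))
        <next : ∀ α → α < next α
        <next α = proj₂ (proj₂ (cofinal α))
        a : ℕ → κ
        a zero = next δ
        -- The skipped point `next (a n)` is the spare one.
        a (suc n) = next (next (a n))
        a-step : ∀ n → a n < a (suc n)
        a-step n = <-trans (<next (a n)) (<next (next (a n)))
        a-mono : ∀ {m n} → m ≤ℕ n → a m ≤ a n
        a-mono m≤n with ℕ.m≤n⇒m<n∨m≡n m≤n
        ... | inj₁ m<n = inj₁ (increasing a a-step m<n)
        ... | inj₂ refl = inj₂ refl
        a∈A : ∀ n → a n ∈ A
        a∈A zero = next∈A δ
        a∈A (suc n) = next∈A (next (a n))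
        δ<a : ∀ n → δ < a n
        δ<a n = <-≤-trans (<next δ) (a-mono {0} {n} z≤n)
        P : κ → Set ℓ
        P ξ = ξ ∈ s ⊎ (∃[ n ] ξ ≡ a n)
        x : 2^κ
        x = ⟦ P ⟧
        end : ∀ {ξ η} → ξ ∈ x → ξ ∉ s → η ∈ s → η < ξ
        end ξ∈x ξ∉s η∈s with ∈⟦⟧⁻ P ξ∈x
        ... | inj₁ ξ∈s = contradiction ξ∈s ξ∉s
        ... | inj₂ (n , refl) = <-trans (s<δ η∈s) (δ<a n)
        diff : Diff⊆ x s A
        diff ξ∈x ξ∉s with ∈⟦⟧⁻ P ξ∈x
        ... | inj₁ ξ∈s = contradiction ξ∈s ξ∉s
        ... | inj₂ (n , refl) = a∈A n
        limit = ω-limit a a-step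
        β = proj₁ limit
        a<β = proj₁ (proj₂ limit)
        reach = proj₂ (proj₂ limit)
        gap : ∀ n {η} → a n < η → η < a (suc n) → ∀ m → η ≢ a m
        gap n a<η η<a m refl with ℕ.≤-<-connex m n
        ... | inj₁ m≤n = ≤⇒≯ (a-mono m≤n) a<η
        ... | inj₂ n<m = ≤⇒≯ (a-mono n<m) η<a
        -- By induction on `n`: either an earlier term already bounds `γ`, or no point of `x` lies
        -- strictly between the previous term (`δ` at the start) and `γ`.
        no-limit : ∀ {γ} → δ < γ → IsLimit x γ → ∀ n → ¬ (γ ≤ a n)
        no-limit δ<γ lim zero γ≤ with lim _ δ<γ
        ... | η , η∈x , δ<η , η<γ with ∈⟦⟧⁻ P η∈x
        ...   | inj₁ η∈s = <-asym (s<δ η∈s) δ<η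
        ...   | inj₂ (m , refl) = ≤⇒≯ (a-mono {0} {m} z≤n) (<-≤-trans η<γ γ≤)
        no-limit {γ} δ<γ lim (suc n) γ≤ with em {P = a n < γ}
        ... | no a≮γ = no-limit δ<γ lim n (≮⇒≥ a≮γ)
        ... | yes a<γ with lim _ a<γ
        ...   | η , η∈x , a<η , η<γ with ∈⟦⟧⁻ P η∈x
        ...     | inj₁ η∈s = <-asym (s<δ η∈s) (<-trans (δ<a n) a<η)
        ...     | inj₂ (m , eq) = gap n a<η (<-≤-trans η<γ γ≤) m eq

      -- A thinning of smaller code would itself be a candidate: passing to a subset creates no new
      -- limit points, so `β` stays the next one.
      minimal⇒blue : ∀ {x β} → Candidate x β → (∀ {y γ} → Candidate y γ → code x β ≤ code y γ) →
                     ¬ Red x δ β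
      minimal⇒blue {x} {β} (((s⊆x , end) , diff) , (δ<β , lim , next)) minimal
        (y , y⊆x , agree , lim' , y<x) = let
            -- `Red` leaves `y` unconstrained from `β` on, so `y` is cut off there.
            P : κ → Set ℓ
            P ξ = ξ < β × ξ ∈ y
            z = ⟦ P ⟧
            z⊆x : z ⊆ₛ x
            z⊆x ξ∈z = case ∈⟦⟧⁻ P ξ∈z of λ (ξ<β , ξ∈y) → y⊆x ξ<β ξ∈y
            y≡z : y ≡[ β ] z
            y≡z ξ<β = ∈-ext y z (λ ξ∈y → ∈⟦⟧⁺ P (ξ<β , ξ∈y)) (λ ξ∈z → proj₂ (∈⟦⟧⁻ P ξ∈z))
            s⊆z : s ⊆ₛ z
            s⊆z ξ∈s = ∈⟦⟧⁺ P (<-trans (s<δ ξ∈s) δ<β , trans (agree (inj₁ (s<δ ξ∈s))) (s⊆x ξ∈s))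
            candidate : Candidate z β
            candidate = ((s⊆z , λ ξ∈z → end (z⊆x ξ∈z)) , λ ξ∈z → diff (z⊆x ξ∈z))
              , δ<β
              , IsLimit-mono (λ η<β → trans (sym (y≡z η<β))) lim'
              , λ δ<γ γ<β → next δ<γ γ<β ∘ IsLimit-mono λ _ → z⊆x
          in ≤⇒≯ (minimal candidate) (subst (λ c → c < code x β) (code-local y≡z) y<x)

      blue-candidate : ∃[ x ] ∃[ β ] Candidate x β × ¬ Red x δ β
      blue-candidate =
        let x , β , c , minimal = minimize Candidate (let x , β , c , _ = spare-candidate in x , β , c)
        in x , β , c , minimal⇒blue c minimal

      -- Adding a point to a candidate that is minimal among those with spare
      -- points increases the code.
      minimal⇒red : ∀ {x β} → Candidate x β → Spare x β →
                    (∀ {y γ} → Candidate y γ × Spare y γ → code x β ≤ code y γ) →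
                    ∃[ y ] Candidate y β × Red y δ β
      minimal⇒red {x} {β} (((s⊆x , end) , diff) , (δ<β , lim , next)) spare minimal
        with spare δ<β
      -- The set `y` is `x` with the spare point `c` added; `x` is the thinning that makes it red.
      ... | c , c∈A , c∉x , δ<c , c<β = y , candidate
        , x , (λ _ → x⊆y) , (λ ξ≤δ → agree (≤-<-trans ξ≤δ δ<c)) , lim , x<y
        where
        P : κ → Set ℓ
        P ξ = ξ ∈ x ⊎ ξ ≡ c
        y = ⟦ P ⟧
        x⊆y : x ⊆ₛ y
        x⊆y ξ∈x = ∈⟦⟧⁺ P (inj₁ ξ∈x)
        agree : ∀ {ξ} → ξ < c → x ξ ≡ y ξ
        agree ξ<c = ∈-ext x y x⊆y λ ξ∈y → case ∈⟦⟧⁻ P ξ∈y of λ where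
          (inj₁ ξ∈x) → ξ∈x
          (inj₂ refl) → contradiction ξ<c <-irrefl
        -- One extra point creates no limit: if the point found is `c`, a further one is sought
        -- above it.
        no-limit : ∀ {γ} → δ < γ → γ < β → ¬ IsLimit y γ
        no-limit δ<γ γ<β lim' = next δ<γ γ<β λ ξ ξ<γ → case lim' ξ ξ<γ of λ where
          (η , η∈y , ξ<η , η<γ) → case ∈⟦⟧⁻ P η∈y of λ where
            (inj₁ η∈x) → η , η∈x , ξ<η , η<γ
            (inj₂ refl) → case lim' η η<γ of λ where
              (ζ , ζ∈y , η<ζ , ζ<γ) → case ∈⟦⟧⁻ P ζ∈y of λ where
                (inj₁ ζ∈x) → ζ , ζ∈x , <-trans ξ<η η<ζ , ζ<γ
                (inj₂ refl) → contradiction η<ζ <-irrefl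
        end' : ∀ {ξ η} → ξ ∈ y → ξ ∉ s → η ∈ s → η < ξ
        end' ξ∈y ξ∉s η∈s with ∈⟦⟧⁻ P ξ∈y
        ... | inj₁ ξ∈x = end ξ∈x ξ∉s η∈s
        ... | inj₂ refl = <-trans (s<δ η∈s) δ<c
        diff' : Diff⊆ y s A
        diff' ξ∈y ξ∉s with ∈⟦⟧⁻ P ξ∈y
        ... | inj₁ ξ∈x = diff ξ∈x ξ∉s
        ... | inj₂ refl = c∈A
        candidate : Candidate y β
        candidate =
          (((λ ξ∈s → x⊆y (s⊆x ξ∈s)) , end') , diff')
          , δ<β , IsLimit-mono (λ _ → x⊆y) lim , no-limit
        other : ∀ {η} → η ∉ x → c < η → η ∉ y
        other η∉x c<η η∈y = case ∈⟦⟧⁻ P η∈y of λ where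
          (inj₁ η∈x) → η∉x η∈x
          (inj₂ refl) → <-irrefl c<η
        spare' : Spare y β
        spare' {ξ} ξ<β with compare ξ c
        ... | tri> _ _ c<ξ = case spare ξ<β of λ where
          (η , η∈A , η∉x , ξ<η , η<β) → η , η∈A , other η∉x (<-trans c<ξ ξ<η) , ξ<η , η<β
        ... | tri≈ _ refl _ = case spare c<β of λ where
          (η , η∈A , η∉x , c<η , η<β) → η , η∈A , other η∉x c<η , c<η , η<β
        ... | tri< ξ<c _ _ = case spare c<β of λ where
          (η , η∈A , η∉x , c<η , η<β) → η , η∈A , other η∉x c<η , <-trans ξ<c c<η , η<β
        -- Minimality of `x` gives `≤`, and equal codes would put `c` into `x`.
        x<y : code x β < code y β
        x<y with minimal (candidate , spare')
        ... | inj₁ lt = lt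
        ... | inj₂ eq = contradiction (trans (code-injective eq c<β) (∈⟦⟧⁺ P (inj₂ refl))) c∉x

      red-candidate : ∃[ x ] ∃[ β ] Candidate x β × Red x δ β
      red-candidate =
        let x , β , (c , spare) , minimal = minimize (λ x β → Candidate x β × Spare x β) spare-candidate
            y , c' , red = minimal⇒red c spare minimal
        in y , β , c' , red

    -- The analytic set.

    RedOnClub : Pred 2^κ ℓ
    RedOnClub x = ∃[ f ] Controls Red f x

    -- A failure at `δ` depends only on `f` up to `δ` and on `x` below `f δ`, because the search for
    -- `β` is bounded by `f δ`.
    RedOnClub-Σ¹₁ : Σ¹₁ RedOnClub
    RedOnClub-Σ¹₁ = C , closed , λ x → mk⇔ id id
      where
      C : Pred (2^κ × κ^κ) ℓ
      C (x , f) = Controls Red f x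
      closed : Closed C
      closed x f ¬C = x ↾ f δ , f ↾ δ' , (λ _ → refl) , (λ _ → refl) , separated
        where
        failure : ∃[ δ ] ¬ (δ ClosedUnder f → ∃[ β ] β < f δ × NextLimit x δ β × Red x δ β)
        failure = ¬∀⇒∃¬ ¬C
        δ = proj₁ failure
        -- The restriction of `f` must include the value at `δ` itself.
        δ' = proj₁ (above δ)
        δ<δ' : δ < δ'
        δ<δ' = proj₂ (above δ)
        separated : ∀ y g → (x ↾ f δ) ⊏ y → (f ↾ δ') ⊏ g → ¬ C (y , g)
        separated y g x⊏y f⊏g Cyg = proj₂ failure λ (nonzero , f-closed) →
          case Cyg δ (nonzero , λ ξ<δ → subst (_< δ) (f⊏g (_ , <-trans ξ<δ δ<δ')) (f-closed ξ<δ)) of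
            λ (β , β<gδ , limit , red) → let
              β<fδ : β < f δ
              β<fδ = subst (β <_) (sym (f⊏g (δ , δ<δ'))) β<gδ
              y≡x : y ≡[ β ] x
              y≡x ξ<β = sym (x⊏y (_ , <-trans ξ<β β<fδ))
            in β , β<fδ , NextLimit-local y≡x limit , Red-local (proj₁ limit) y≡x red

    -- Two clubs meet: at a closure point of a function above both `f` and `g`, the same next limit
    -- would receive both colours.
    blue⇒∉RedOnClub : ∀ {x} g → Controls (λ x δ β → ¬ Red x δ β) g x → ¬ RedOnClub x
    blue⇒∉RedOnClub {x} g blue (f , red) =
      let h : ∀ ξ → ∃[ γ ] f ξ < γ × g ξ < γ
          h ξ = above₂ (f ξ) (g ξ)
          δ , nonzero , closed = closure-point (proj₁ ∘ h)
          _ , _ , limit , r = red δ (nonzero , λ ξ<δ → <-trans (proj₁ (proj₂ (h _))) (closed ξ<δ))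
          _ , _ , limit' , ¬r = blue δ (nonzero , λ ξ<δ → <-trans (proj₂ (proj₂ (h _))) (closed ξ<δ))
      in ¬r (subst (Red x δ) (NextLimit-unique limit limit') r)

  -- Conditions, trees and branches.

  module Generic (𝒜 : Pred 2^κ ℓ) (𝒜⊆[κ]^κ : 𝒜 ⊆ [κ]^κ) (reading : Reading)
                 (treeForcing : Forcing.Mathias.IsTreeForcing 𝜿 𝒜 reading)
                 (<κ-closed : Forcing.Mathias.<κ-Closed 𝜿 𝒜 reading) where

    open Forcing 𝜿 using ([_]; Below)
    open Forcing.Mathias 𝜿 𝒜 reading

    -- This and `below-⊆` are the only facts used about the side condition, which covers both
    -- readings.
    below⇒< : ∀ r {s A} → Below r s A → ∀ {ξ η} → ξ ∈ s → η ∈ A → ξ < η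
    below⇒< strict (_ , (bound , _) , σ<A) ξ∈s η∈A = ≤-<-trans (bound ξ∈s) (σ<A η∈A)
    below⇒< pointwise s<A ξ∈s η∈A = s<A ξ∈s η∈A

    below-⊆ : ∀ r {s t A} → s ⊆ₛ t → Below r t A → Below r s A
    -- The smaller stem needs a supremum of its own, which is at most `σ`.
    below-⊆ strict {s} s⊆t (σ , (bound , _) , σ<A)
      with least (λ τ → ∀ {ξ} → ξ ∈ s → ξ ≤ τ) (σ , λ ξ∈s → bound (s⊆t ξ∈s))
    ... | τ , bound' , minimal = τ , (bound' , λ _ h → minimal h)
      , λ η∈A → ≤-<-trans (minimal λ ξ∈s → bound (s⊆t ξ∈s)) (σ<A η∈A)
    below-⊆ pointwise s⊆t t<A ξ∈s η∈A = t<A (s⊆t ξ∈s) η∈A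

    trim : ∀ p s → s ⊆ₛ stem p → Condition
    trim p s s⊆ = record
      { stem = s ; side = side p ; small = ⊆-small s⊆ (small p) ; side∈ = side∈ p
      ; below = below-⊆ reading s⊆ (below p) }

    trim-≼ : ∀ {p q s} (s⊆ : s ⊆ₛ stem q) → stem p ⊆ₛ s → q ≼ p → trim q s s⊆ ≼ p
    trim-≼ s⊆ p⊆s ((_ , end) , side⊆ , diff) =
      (p⊆s , λ ξ∈s → end (s⊆ ξ∈s)) , side⊆ , λ ξ∈s → diff (s⊆ ξ∈s)

    ≼-trans : ∀ {p q r} → r ≼ q → q ≼ p → r ≼ p
    ≼-trans {p} {q} {r} ((q⊆r , end) , side⊆ , diff) ((p⊆q , end') , side⊆' , diff') =
      ((λ ξ∈ → q⊆r (p⊆q ξ∈)) , end'') , (λ η∈ → side⊆' (side⊆ η∈)) , diff''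
      where
      end'' : ∀ {ξ η} → ξ ∈ stem r → ξ ∉ stem p → η ∈ stem p → η < ξ
      end'' {ξ} ξ∈r ξ∉p η∈p with stem q ξ Bool.≟ true
      ... | yes ξ∈q = end' ξ∈q ξ∉p η∈p
      ... | no ξ∉q = end ξ∈r ξ∉q (p⊆q η∈p)
      diff'' : Diff⊆ (stem r) (stem p) (side p)
      diff'' {ξ} ξ∈r ξ∉p with stem q ξ Bool.≟ true
      ... | yes ξ∈q = diff' ξ∈q ξ∉p
      ... | no ξ∉q = side⊆' (diff ξ∈r ξ∉q)

    extension⇒branch : ∀ {p x} → Extension (stem p) (side p) x → [ tree p ] x
    extension⇒branch {x = x} (end , diff) _ = x , end , diff , λ _ → refl

    -- Each requirement concerns a single point `ξ` and is read off from a node of length above `ξ`.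
    branch⇒extension : ∀ {p x} → [ tree p ] x → Extension (stem p) (side p) x
    branch⇒extension {p} {x} branch = (s⊆x , end) , diff
      where
      s⊆x : stem p ⊆ₛ x
      s⊆x {ξ} ξ∈s with above ξ
      ... | α , ξ<α with branch α
      ... | y , (s⊆y , _) , _ , x⊏y = trans (x⊏y (ξ , ξ<α)) (s⊆y ξ∈s)
      end : ∀ {ξ η} → ξ ∈ x → ξ ∉ stem p → η ∈ stem p → η < ξ
      end {ξ} ξ∈x ξ∉s η∈s with above ξ
      ... | α , ξ<α with branch α
      ... | y , (_ , end') , _ , x⊏y = end' (trans (sym (x⊏y (ξ , ξ<α))) ξ∈x) ξ∉s η∈s
      diff : Diff⊆ x (stem p) (side p)
      diff {ξ} ξ∈x ξ∉s with above ξ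
      ... | α , ξ<α with branch α
      ... | y , _ , diff' , x⊏y = diff' (trans (sym (x⊏y (ξ , ξ<α))) ξ∈x) ξ∉s

    stem-branch : ∀ p → [ tree p ] (stem p)
    stem-branch p = extension⇒branch {p}
      ((id , λ ξ∈ ξ∉ → contradiction ξ∈ ξ∉) , λ ξ∈ ξ∉ → contradiction ξ∈ ξ∉)

    -- The stem of q and the union of its stem with its side are branches of
    -- its tree.
    tree-⊆⇒≼ : ∀ {p q} → (∀ u → tree q u → tree p u) → q ≼ p
    tree-⊆⇒≼ {p} {q} q⊆p with branch⇒extension {p} (λ α → q⊆p _ (stem-branch q α))
    ... | (p⊆q , end) , diff = (p⊆q , end) , side⊆ , diff
      where
      P : κ → Set
      P ξ = ξ ∈ stem q ⊎ ξ ∈ side q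
      whole-branch : [ tree q ] ⟦ P ⟧
      whole-branch = extension⇒branch {q} (((λ ξ∈ → ∈⟦⟧⁺ P (inj₁ ξ∈)) , end') , diff')
        where
        diff' : Diff⊆ ⟦ P ⟧ (stem q) (side q)
        diff' ξ∈ ξ∉s with ∈⟦⟧⁻ P ξ∈
        ... | inj₁ ξ∈s = contradiction ξ∈s ξ∉s
        ... | inj₂ ξ∈A = ξ∈A
        end' : ∀ {ξ η} → ξ ∈ ⟦ P ⟧ → ξ ∉ stem q → η ∈ stem q → η < ξ
        end' ξ∈ ξ∉s η∈s = below⇒< reading (below q) η∈s (diff' ξ∈ ξ∉s)
      side⊆ : side q ⊆ₛ side p
      side⊆ η∈A = proj₂ (branch⇒extension {p} λ α → q⊆p _ (whole-branch α)) (∈⟦⟧⁺ P (inj₂ η∈A))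
        λ η∈s → <-irrefl (below⇒< reading (below q) (p⊆q η∈s) η∈A)

    -- The subtree above the node `x ↾ β` is the tree of a condition `q`. The stem of `q` is a
    -- branch of it, and comparable nodes of the same length `β` agree.
    extend : ∀ p {x} β → Extension (stem p) (side p) x → ∃[ q ] (q ≼ p) × (stem q ≡[ β ] x)
    extend p {x} β e with treeForcing p (x ↾ β) (extension⇒branch {p} e β)
    ... | q , q⇔ = q , tree-⊆⇒≼ {p} {q} (λ u u∈ → proj₁ (Equivalence.to (q⇔ u) u∈))
      , agree (proj₂ (Equivalence.to (q⇔ _) (stem-branch q β)))
      where
      agree : (stem q ↾ β) ⊑ (x ↾ β) ⊎ (x ↾ β) ⊑ (stem q ↾ β) → stem q ≡[ β ] x
      agree (inj₁ (_ , eq)) ξ<β = eq _ ξ<β ξ<β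
      agree (inj₂ (_ , eq)) ξ<β = sym (eq _ ξ<β ξ<β)

    -- The bound given by closure may have too long a stem, so it is cut back
    -- to the union of the given stems.
    lower-bound : ∀ {α δ p₀} (p : Seg α → Condition) →
      (∀ β γ → proj₁ β < proj₁ γ → p γ ≼ p β) → (∀ β → p β ≼ p₀) →
      (∀ {ξ} → ξ ∈ stem p₀ → ξ < δ) → (∀ β {ξ} → ξ ∈ stem (p β) → ξ < δ) →
      ∃[ q ] (q ≼ p₀) × (∀ β → q ≼ p β) × (∀ {ξ} → ξ ∈ stem q → ξ < δ)
    lower-bound {α} {δ} {p₀} p descending p≼p₀ p₀<δ p<δ with em {P = Seg α}
    -- The empty union of stems would lose the stem of `p₀`, so `p₀` itself is the bound.
    ... | no empty = p₀ , tree-⊆⇒≼ {p₀} {p₀} (λ _ → id) , (λ β → contradiction β empty) , p₀<δ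
    ... | yes o with <κ-closed α p descending
    ... | q , q≼p = r , ≼-trans {p₀} {p o} {r} (r≼p o) (p≼p₀ o) , r≼p
      , λ ξ∈ → let β , ξ∈β = ∈⟦⟧⁻ P ξ∈ in p<δ β ξ∈β
      where
      P : κ → Set ℓ
      P ξ = ∃[ β ] ξ ∈ stem (p β)
      P⊆q : ⟦ P ⟧ ⊆ₛ stem q
      P⊆q ξ∈ = let β , ξ∈β = ∈⟦⟧⁻ P ξ∈ in proj₁ (proj₁ (q≼p β)) ξ∈β
      r : Condition
      r = trim q ⟦ P ⟧ P⊆q
      r≼p : ∀ β → r ≼ p β
      r≼p β = trim-≼ {p β} {q} P⊆q (λ ξ∈ → ∈⟦⟧⁺ P (β , ξ∈)) (q≼p β)

    -- A generic branch of prescribed colour.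

    module _ (K : 2^κ → κ → κ → Set ℓ)
             (K-local : ∀ {x y δ β} → δ < β → x ≡[ β ] y → K x δ β → K y δ β)
             (select : ∀ {s A δ} → (∀ {ξ} → ξ ∈ s → ξ < δ) → (∀ α → ∃[ η ] η ∈ A × α < η) →
                       ∃[ x ] ∃[ β ] (Extension s A x × NextLimit x δ β) × K x δ β)
             (p₀ : Condition) (N : κ → Pred 2^κ ℓ) (N-nowhereDense : ∀ ν → NowhereDense (N ν)) where

      α₀ : κ
      α₀ = proj₁ (small⇒bounded (small p₀))

      -- K is arranged at the least δ above all earlier bounds, so that δ = ν
      -- at every closure point ν of the bounds.
      record Stage ν (s : Seg ν → Condition × κ) (stage : Condition × κ) : Set ℓ where
        p = proj₁ stage
        α = proj₂ stage
        field
          ≼-start     : p ≼ p₀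
          ≼-previous  : ∀ μ → p ≼ proj₁ (s μ)
          stem<       : ∀ {ξ} → ξ ∈ stem p → ξ < α
          avoids      : [ tree p ] ⊆ ∁ (N ν)
          δ β         : κ
          α₀<δ        : α₀ < δ
          previous<δ  : ∀ μ → proj₂ (s μ) < δ
          δ-least     : ∀ {γ} → α₀ < γ × (∀ μ → proj₂ (s μ) < γ) → δ ≤ γ
          β<α         : β < α
          nextLimit   : NextLimit (stem p) δ β
          coloured    : K (stem p) δ β

      -- First bound the earlier stages, then append a coloured block up to `β`, then shrink to
      -- avoid `N ν`. The shrinking adds nothing below `β`, which is already a limit of the stem.
      next-stage : ∀ ν s → (∀ μ → Stage (proj₁ μ) (restrict s μ) (s μ)) → ∃ (Stage ν s)
      next-stage ν s stage =
        let
          b , s<b = regular ν (proj₂ ∘ s)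
          b' , b<b' , α₀<b' = above₂ b α₀
          δ , (α₀<δ , s<δ) , δ-least = least (λ γ → α₀ < γ × (∀ μ → proj₂ (s μ) < γ))
            (b' , α₀<b' , λ μ → <-trans (s<b μ) b<b')
          q , q≼p₀ , q≼s , q<δ = lower-bound {p₀ = p₀} (proj₁ ∘ s)
            -- The history of `μ'` reaches `μ` with another proof of `μ < ν`.
            (λ μ μ' μ<μ' → subst (λ μ<ν → proj₁ (s μ') ≼ proj₁ (s (proj₁ μ , μ<ν)))
              (<-irrelevant _ _) (Stage.≼-previous (stage μ') (proj₁ μ , μ<μ')))
            (λ μ → Stage.≼-start (stage μ))
            (λ ξ∈ → <-trans (proj₂ (small⇒bounded (small p₀)) ξ∈) α₀<δ)
            (λ μ ξ∈ → <-trans (Stage.stem< (stage μ) ξ∈) (s<δ μ))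
          x , β , (x-ext , x-limit) , x-coloured = select q<δ (unbounded (𝒜⊆[κ]^κ (side∈ q)))
          q' , q'≼q , q'≡x = extend q β x-ext
          q'-limit = NextLimit-local (≡[]-sym {stem q'} q'≡x) x-limit
          r , r≼q' , r-avoids = N-nowhereDense ν q'
          q'≡r = EndExtends-limit (proj₁ r≼q') (proj₁ (proj₂ q'-limit))
          r-bound , r< = small⇒bounded (small r)
          α , r-bound<α , β<α = above₂ r-bound β
          r≼q = ≼-trans {q} {q'} {r} r≼q' q'≼q
        in (r , α) , record
          { ≼-start = ≼-trans {p₀} {q} {r} r≼q q≼p₀
          ; ≼-previous = λ μ → ≼-trans {proj₁ (s μ)} {q} {r} r≼q (q≼s μ)
          ; stem< = λ ξ∈ → <-trans (r< ξ∈) r-bound<α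
          ; avoids = r-avoids
          ; δ = δ ; β = β
          ; α₀<δ = α₀<δ ; previous<δ = s<δ ; δ-least = δ-least ; β<α = β<α
          ; nextLimit = NextLimit-local q'≡r q'-limit
          ; coloured = K-local (proj₁ x-limit) q'≡r
              (K-local (proj₁ x-limit) (≡[]-sym {stem q'} q'≡x) x-coloured)
          }

      -- The union of the stems is a branch of the tree of every stage, so it avoids every `N ν`;
      -- `g` dominates the bounds of the stages.
      generic-branch : ∃[ x ] [ tree p₀ ] x × (∀ ν → ¬ N ν x) × ∃[ g ] Controls K g x
      generic-branch = from-stages (dependent-choice Stage (p₀ , α₀) next-stage)
        where
        from-stages : (Σ[ f ∈ (κ → Condition × κ) ] ∀ ν → Stage ν (f ∘ proj₁) (f ν)) →
                      ∃[ x ] [ tree p₀ ] x × (∀ ν → ¬ N ν x) × ∃[ g ] Controls K g x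
        from-stages (f , stage) = x , branch p₀ (proj₁ pair) (λ ν → Stage.≼-start (stage ν))
          , (λ ν → Stage.avoids (stage ν) (branch-stage ν)) , g , controls
          where
          module S ν = Stage (stage ν)
          P : κ → Set ℓ
          P ξ = ∃[ ν ] ξ ∈ stem (S.p ν)
          x : 2^κ
          x = ⟦ P ⟧
          descending : ∀ {μ ν} → μ < ν → S.p ν ≼ S.p μ
          descending μ<ν = S.≼-previous _ (_ , μ<ν)
          later : ∀ {μ ν} → μ ≤ ν → stem (S.p μ) ⊆ₛ stem (S.p ν)
          later (inj₁ μ<ν) = proj₁ (proj₁ (descending μ<ν))
          later (inj₂ refl) = id
          branch-from : ∀ p → stem p ⊆ₛ x →
                        (∀ {ξ} → ξ ∈ x → ξ ∉ stem p → ∃[ ν ] ξ ∈ stem (S.p ν) × S.p ν ≼ p) → [ tree p ] x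
          branch-from p p⊆x new = extension⇒branch {p}
            ( (p⊆x , λ ξ∈x ξ∉p → let _ , ξ∈ν , ((_ , end) , _) = new ξ∈x ξ∉p in end ξ∈ν ξ∉p)
            , λ ξ∈x ξ∉p → let _ , ξ∈ν , (_ , _ , diff) = new ξ∈x ξ∉p in diff ξ∈ν ξ∉p )
          branch : ∀ p (o : κ) → (∀ ν → S.p ν ≼ p) → [ tree p ] x
          branch p o ≼p = branch-from p
            (λ ξ∈p → ∈⟦⟧⁺ P (o , proj₁ (proj₁ (≼p o)) ξ∈p))
            λ ξ∈x _ → let ν , ξ∈ν = ∈⟦⟧⁻ P ξ∈x in ν , ξ∈ν , ≼p ν
          branch-stage : ∀ μ → [ tree (S.p μ) ] x
          -- A point outside the stem of stage `μ` must come from a later stage, as earlier stems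
          -- are contained in it.
          branch-stage μ = branch-from (S.p μ) (λ ξ∈ → ∈⟦⟧⁺ P (μ , ξ∈)) λ ξ∈x ξ∉μ →
            let ν , ξ∈ν = ∈⟦⟧⁻ P ξ∈x
            in ν , ξ∈ν , descending (decidable-stable em λ μ≮ν → ξ∉μ (later (≮⇒≥ μ≮ν) ξ∈ν))
          -- δ ν < ν would give δ (δ ν) < δ ν.
          ν≤δ : ∀ ν → ν ≤ S.δ ν
          ν≤δ ν = ≮⇒≥ (All.wfRec <-wellFounded _ (λ ν → ¬ (S.δ ν < ν)) (λ ν rec δ<ν →
            rec δ<ν (<-trans (proj₁ (S.nextLimit (S.δ ν)))
                    (<-trans (S.β<α (S.δ ν)) (S.previous<δ ν (_ , δ<ν))))) ν)
          gs : ∀ ν → ∃[ γ ] S.α ν < γ × α₀ < γ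
          gs ν = above₂ (S.α ν) α₀
          g : κ^κ
          g ν = proj₁ (gs ν)
          controls : Controls K g x
          controls δ ((o , o<δ) , closed) = S.β δ , <-trans (S.β<α δ) (proj₁ (proj₂ (gs δ)))
            , subst (λ γ → NextLimit x γ (S.β δ) × K x γ (S.β δ)) δδ≡δ
                ( NextLimit-local stem≡x (S.nextLimit δ)
                , K-local (proj₁ (S.nextLimit δ)) stem≡x (S.coloured δ) )
            where
            δδ≡δ : S.δ δ ≡ δ
            -- The ordinal `o` puts `α₀` below `δ`, and closure under `g` does so for the bounds of
            -- the earlier stages.
            δδ≡δ = case S.δ-least δ
                ( <-trans (proj₂ (proj₂ (gs o))) (closed o<δ)
                , λ (_ , ξ<δ) → <-trans (proj₁ (proj₂ (gs _))) (closed ξ<δ) ) of λ where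
              (inj₁ lt) → contradiction lt (≤⇒≯ (ν≤δ δ))
              (inj₂ eq) → eq
            stem≡x : stem (S.p δ) ≡[ S.β δ ] x
            stem≡x = EndExtends-limit (proj₁ (branch⇒extension {S.p δ} (branch-stage δ)))
              (proj₁ (proj₂ (S.nextLimit δ)))

    -- Whichever part of the tree of `q` is claimed to be meager, a generic branch of the matching
    -- colour lies in it but outside the covering sets.
    RedOnClub-¬measurable : (enc : κ^<κ≡κ) → ¬ Measurable (Coloring.RedOnClub enc)
    RedOnClub-¬measurable enc measurable = refute {some-condition} (measurable some-condition)
      where
      open Coloring enc
      -- A lower bound of the empty sequence.
      some-condition : Condition
      some-condition =
        let o , o≤ = minimum
        in proj₁ (<κ-closed o (λ (ν , ν<o) → contradiction ν<o (≤⇒≯ (o≤ ν)))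
             λ (ν , ν<o) → contradiction ν<o (≤⇒≯ (o≤ ν)))
      refute : ∀ {p} → (∃[ q ] (q ≼ p) × (Meager ([ tree q ] ∩ RedOnClub) ⊎ Meager ([ tree q ] ∖ RedOnClub))) → ⊥
      refute (q , _ , inj₁ (N , nowhereDense , covers)) =
        let x , x∈q , x∉N , g , red = generic-branch Red Red-local red-candidate q N nowhereDense
            ν , x∈N = covers (x∈q , g , red)
        in x∉N ν x∈N
      refute (q , _ , inj₂ (N , nowhereDense , covers)) =
        let x , x∈q , x∉N , g , blue = generic-branch (λ x δ β → ¬ Red x δ β)
              (λ δ<β x≡y ¬red red → ¬red (Red-local δ<β (≡[]-sym x≡y) red)) blue-candidate q N nowhereDense
            ν , x∈N = covers (x∈q , blue⇒∉RedOnClub g blue)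
        in x∉N ν x∈N

corollary32 : (∀ {a} → ExcludedMiddle a) →
    (∀ {a b} → Extensionality a b) →
    ∀ {ℓ} (𝜿 : UncountableRegularCardinal ℓ) →
    GeneralizedReals.κ^<κ≡κ 𝜿 →
    (𝒜 : Pred (GeneralizedReals.2^κ 𝜿) ℓ) →
    Satisfiable 𝒜 →
    𝒜 ⊆ GeneralizedReals.[κ]^κ 𝜿 →
    (reading : Reading) →
    Forcing.Mathias.IsTreeForcing 𝜿 𝒜 reading →
    Forcing.Mathias.<κ-Closed 𝜿 𝒜 reading →
    Forcing.Mathias.Fusion 𝜿 𝒜 reading →
    Σ[ X ∈ Pred (GeneralizedReals.2^κ 𝜿) ℓ ]
    (GeneralizedReals.Σ¹₁ 𝜿 X × ¬ Forcing.Mathias.Measurable 𝜿 𝒜 reading X)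
corollary32 em ext 𝜿 enc 𝒜 _ 𝒜⊆ reading treeForcing closed _ =
    C.RedOnClub , C.RedOnClub-Σ¹₁
  , Classical.Generic.RedOnClub-¬measurable em ext 𝜿 𝒜 𝒜⊆ reading treeForcing closed enc
  where module C = Classical.Coloring em ext 𝜿 enc
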